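{- Let $\Sigma=\{a,b\}$ and let $h:\Sigma^*\to\Sigma^*$ be the morphism given by $h(a)=abaaaba$ and $h(b)=babab$. Then the fixed point $h^\omega(a)$ contains abelian $8$-powers.
   Context: $\Sigma^*$ is the free monoid of finite words over $\Sigma$; a morphism is a monoid homomorphism. Since $h(a)$ begins with $a$ and has length greater than $1$, each $h^n(a)$ is a proper prefix of $h^{n+1}(a)$, and $h^\omega(a)$ denotes the infinite word having every $h^n(a)$ as a prefix (a fixed point of $h$). A word contains an abelian $k$-power if it has a factor (contiguous finite subword) of the form $v_1v_2\cdots v_k$ where $v_1,\dots,v_k$ are non-empty words that are permutations (anagrams) of one another. -}

module Defs where

open import Algebra.Morphism.Structures using (module MonoidMorphisms)
open import Data.Fin.Base using (Fin; zero; suc; toℕ; fromℕ<)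
open import Data.Fin.Properties using (toℕ-fromℕ<)
open import Data.List.Base
  using (List; []; _∷_; [_]; _++_; concat; concatMap; length; lookup; ++-[]-rawMonoid)
open import Data.List.Properties using (++-assoc; ++-identityʳ; concatMap-++; length-++)
open import Data.List.Relation.Binary.Permutation.Propositional using (_↭_)
open import Data.Nat.Base using (ℕ; zero; suc; _+_; _<_; z≤n; s≤s; _≤′_; ≤′-refl; ≤′-step)
open import Data.Nat.GeneralisedArithmetic using (fold)
open import Data.Nat.Properties
  using (+-comm; +-monoʳ-≤; suc-injective; ≤-total; ≤-trans; ≤-reflexive; ≤⇒≤′)
open import Data.Product.Base using (_×_; _,_; ∃; ∃-syntax)
open import Data.Sum.Base using (inj₁; inj₂)
open import Data.Vec.Base as Vec using (Vec)
open import Relation.Binary.PropositionalEquality using (_≡_; _≢_; refl; sym; trans; cong)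

Word∞ : Set → Set
Word∞ A = ℕ → A

module _ {A : Set} where

  OccursAt : ℕ → List A → Word∞ A → Set
  OccursAt p u w = (i : Fin (length u)) → lookup u i ≡ w (p + toℕ i)

  _PrefixOf_ : List A → Word∞ A → Set
  u PrefixOf w = OccursAt 0 u w

  _FactorOf_ : List A → Word∞ A → Set
  u FactorOf w = ∃[ p ] OccursAt p u w

  AbelianPower : ℕ → List A → Set
  AbelianPower k u = ∃ λ (v : Vec (List A) k) →
    (∀ i → Vec.lookup v i ≢ []) ×
    (∀ i j → Vec.lookup v i ↭ Vec.lookup v j) ×
    u ≡ concat (Vec.toList v)

  ContainsAbelianPower : ℕ → Word∞ A → Set
  ContainsAbelianPower k w = ∃[ u ] (AbelianPower k u × u FactorOf w)

data Letter : Set where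
  a b : Letter

image : Letter → List Letter
image a = a ∷ b ∷ a ∷ a ∷ a ∷ b ∷ a ∷ []
image b = b ∷ a ∷ b ∷ a ∷ b ∷ []

h : List Letter → List Letter
h = concatMap image

open MonoidMorphisms (++-[]-rawMonoid Letter) (++-[]-rawMonoid Letter)
  using (IsMonoidHomomorphism)

h-isMonoidHomomorphism : IsMonoidHomomorphism h
h-isMonoidHomomorphism = record
  { isMagmaHomomorphism = record
    { isRelHomomorphism = record { cong = cong h }
    ; homo              = concatMap-++ image
    }
  ; ε-homo = refl
  }

h^_⟨a⟩ : ℕ → List Letter
h^ n ⟨a⟩ = fold [ a ] h n

private
  h-nonempty : ∀ u → u ≢ [] → h u ≢ []
  h-nonempty []      ne _ = ne refl
  h-nonempty (a ∷ u) _  ()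
  h-nonempty (b ∷ u) _  ()

h^-step : ∀ n → ∃[ s ] (s ≢ [] × h^ suc n ⟨a⟩ ≡ h^ n ⟨a⟩ ++ s)
h^-step zero    = b ∷ a ∷ a ∷ a ∷ b ∷ a ∷ [] , (λ ()) , refl
h^-step (suc n) with s , s≢[] , eq ← h^-step n =
  h s , h-nonempty s s≢[] , trans (cong h eq) (concatMap-++ image (h^ n ⟨a⟩) s)

n<∣h^n⟨a⟩∣ : ∀ n → n < length (h^ n ⟨a⟩)
n<∣h^n⟨a⟩∣ zero    = s≤s z≤n
n<∣h^n⟨a⟩∣ (suc n) with h^-step n
... | []    , s≢[] , _  with () ← s≢[] refl
... | x ∷ s , _    , eq = ≤-trans (s≤s (n<∣h^n⟨a⟩∣ n)) (≤-trans
  (≤-trans (≤-reflexive (+-comm 1 _)) (+-monoʳ-≤ (length (h^ n ⟨a⟩)) (s≤s z≤n)))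
  (≤-reflexive (sym (trans (cong length eq) (length-++ (h^ n ⟨a⟩))))))

-- Letter n can be read off hⁿ(a), which has length greater than n;
-- hω-prefix shows that the result is the limit of the words hⁿ(a).
hω : Word∞ Letter
hω n = lookup (h^ n ⟨a⟩) (fromℕ< (n<∣h^n⟨a⟩∣ n))

private
  h^-mono′ : ∀ {m n} → m ≤′ n → ∃[ s ] h^ n ⟨a⟩ ≡ h^ m ⟨a⟩ ++ s
  h^-mono′ ≤′-refl = [] , sym (++-identityʳ _)
  h^-mono′ {m} (≤′-step {n} m≤n)
    with s , eq ← h^-mono′ m≤n | t , _ , eq′ ← h^-step n =
    s ++ t , trans eq′ (trans (cong (_++ t) eq) (++-assoc (h^ m ⟨a⟩) s t))

  lookup-prefix : ∀ (xs : List Letter) {ys zs} → zs ≡ xs ++ ys →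
                  (i : Fin (length xs)) (j : Fin (length zs)) →
                  toℕ i ≡ toℕ j → lookup xs i ≡ lookup zs j
  lookup-prefix (x ∷ xs) refl zero    zero    _  = refl
  lookup-prefix (x ∷ xs) refl (suc i) (suc j) eq =
    lookup-prefix xs refl i j (suc-injective eq)

hω-prefix : ∀ n → (h^ n ⟨a⟩) PrefixOf hω
hω-prefix n i with ≤-total n (toℕ i)
... | inj₁ n≤i with _ , eq ← h^-mono′ (≤⇒≤′ n≤i) =
  lookup-prefix (h^ n ⟨a⟩) eq i _ (sym (toℕ-fromℕ< _))
... | inj₂ i≤n with _ , eq ← h^-mono′ (≤⇒≤′ i≤n) =
  sym (lookup-prefix (h^ toℕ i ⟨a⟩) eq _ i (toℕ-fromℕ< _))

{-# OPTIONS --safe #-}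
module Submission where

open import Data.Fin.Base using (zero; suc)
open import Data.List.Base using (List; []; _∷_; _++_; concat; take; drop; replicate)
open import Data.List.Properties using (take++drop≡id; ++-assoc)
open import Data.List.Relation.Binary.Permutation.Propositional
  using (_↭_; ↭-refl; ↭-sym; ↭-trans; prep)
open import Data.List.Relation.Binary.Permutation.Propositional.Properties using (shift)
open import Data.Nat.Base using (ℕ; zero; suc)
open import Data.Product.Base using (_×_; _,_; ∃-syntax; map₁; map₂; proj₁; proj₂)
open import Data.Vec.Base as Vec using (Vec; []; _∷_)
open import Data.Vec.Properties using (lookup-map; lookup-replicate)
open import Function.Base using (_∘_)
open import Relation.Binary.PropositionalEquality
  using (_≡_; _≢_; refl; sym; trans; cong; subst)

open import Defs

-- An abelian power is a finite object, so it suffices to exhibit one inside some `h^ n ⟨a⟩`: each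
-- of these is a prefix of `hω`, and a factor of a prefix is a factor (`blocks-factor`). Words with
-- the same Parikh vector, the pair counting `a` and `b`, are anagrams (`parikh-≡⇒↭`). What remains
-- is to compute eight pairs of numbers for consecutive blocks of the sixth iterate.

module _ {A : Set} where

  -- Passing to the shifted word `w ∘ suc` keeps the occurrence at position 0, so indices match by
  -- computation.
  ++-prefixˡ : ∀ w (u : List A) {ys} → (u ++ ys) PrefixOf w → u PrefixOf w
  ++-prefixˡ w (x ∷ u) occ zero    = occ zero
  ++-prefixˡ w (x ∷ u) occ (suc i) = ++-prefixˡ (w ∘ suc) u (occ ∘ suc) i

  ++-factor : ∀ w (xs u : List A) {ys} → (xs ++ u ++ ys) PrefixOf w → u FactorOf w
  ++-factor w []       u occ = 0 , ++-prefixˡ w u occ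
  ++-factor w (x ∷ xs) u occ
    with p , occ′ ← ++-factor (w ∘ suc) xs u (occ ∘ suc) = suc p , occ′

  blocks : ∀ k → ℕ → List A → Vec (List A) k
  blocks zero    m xs = []
  blocks (suc k) m xs = take m xs ∷ blocks k m (drop m xs)

  concat-blocks : ∀ k m xs → ∃[ ys ] concat (Vec.toList (blocks k m xs)) ++ ys ≡ xs
  concat-blocks zero    m xs = xs , refl
  concat-blocks (suc k) m xs with ys , eq ← concat-blocks k m (drop m xs) =
    ys , trans (++-assoc (take m xs) _ ys)
               (trans (cong (take m xs ++_) eq) (take++drop≡id m xs))

  blocks-factor : ∀ w n k m xs → xs PrefixOf w →
                  concat (Vec.toList (blocks k m (drop n xs))) FactorOf w
  blocks-factor w n k m xs occ with ys , eq ← concat-blocks k m (drop n xs) =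
    ++-factor w (take n xs) (concat (Vec.toList (blocks k m (drop n xs))))
              (subst (_PrefixOf w) (sym split) occ)
    where
    split : take n xs ++ concat (Vec.toList (blocks k m (drop n xs))) ++ ys ≡ xs
    split = trans (cong (take n xs ++_) eq) (take++drop≡id n xs)

parikh : List Letter → ℕ × ℕ
parikh []      = 0 , 0
parikh (a ∷ u) = map₁ suc (parikh u)
parikh (b ∷ u) = map₂ suc (parikh u)

normalForm : ℕ × ℕ → List Letter
normalForm (m , n) = replicate m a ++ replicate n b

-- Sorting by insertion: a leading `b` is moved past all the `a`s of the sorted tail.
↭-normalForm : ∀ u → u ↭ normalForm (parikh u)
↭-normalForm []      = ↭-refl
↭-normalForm (a ∷ u) = prep a (↭-normalForm u)
↭-normalForm (b ∷ u) = ↭-trans (prep b (↭-normalForm u))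
  (↭-sym (shift b (replicate (proj₁ (parikh u)) a) (replicate (proj₂ (parikh u)) b)))

parikh-≡⇒↭ : ∀ {u v} → parikh u ≡ parikh v → u ↭ v
parikh-≡⇒↭ {u} {v} eq = ↭-trans (↭-normalForm u)
  (subst (λ c → normalForm c ↭ v) (sym eq) (↭-sym (↭-normalForm v)))

-- Anagrams and non-emptiness both follow from one vector equation, which evaluation can decide; the
-- empty word has Parikh vector `(0 , 0)`.
parikh-constant⇒AbelianPower : ∀ {k c} (v : Vec (List Letter) k) → c ≢ (0 , 0) →
  Vec.map parikh v ≡ Vec.replicate k c → AbelianPower k (concat (Vec.toList v))
parikh-constant⇒AbelianPower {k} {c} v c≢0 eq =
  v , (λ i vᵢ≡[] → c≢0 (trans (sym (parikh-lookup i)) (cong parikh vᵢ≡[])))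
    , (λ i j → parikh-≡⇒↭ (trans (parikh-lookup i) (sym (parikh-lookup j))))
    , refl
  where
  parikh-lookup : ∀ i → parikh (Vec.lookup v i) ≡ c
  parikh-lookup i = trans (sym (lookup-map i parikh v))
    (trans (cong (λ cs → Vec.lookup cs i) eq) (lookup-replicate i c))

-- Found by computer search: h⁶(a) has length 68853, and its eight consecutive
-- blocks of length 2286 from position 23864 on are anagrams of one another.
witness : Vec (List Letter) 8
witness = blocks 8 2286 (drop 23864 (h^ 6 ⟨a⟩))

parikh-witness : Vec.map parikh witness ≡ Vec.replicate 8 (1414 , 872)
-- The type checker evaluates `h^ 6 ⟨a⟩` and counts letters. As 1414 + 872 = 2286, no block is cut
-- short by the end of the word.
parikh-witness = refl

proposition3p6 : ContainsAbelianPower 8 hω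
proposition3p6 =
  concat (Vec.toList witness)
  , parikh-constant⇒AbelianPower witness (λ ()) parikh-witness
  , blocks-factor hω 23864 8 2286 (h^ 6 ⟨a⟩) (hω-prefix 6)
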